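{- For every integer $k\ge4$, put $$h_k=\operatorname{CH}(k-1,k-1)=f(2,k),\qquad c_k=\max\{\operatorname{CH}(k-1,k-2),\,3(k-1)\}.$$ Then $$f(3,k)\ \le\ \frac{k-1}{2}\bigl(c_k+3h_k-1\bigr).$$
   Context: All set families are finite families of distinct sets, and all graphs are finite and simple. A family is $w$-uniform if all its members have exactly $w$ elements (the ground set is an arbitrary finite set, not fixed). A $k$-sunflower is a collection of $k$ distinct sets $A_1,\dots,A_k$ for which there is a set $C$ (the core, possibly empty) with $A_i\cap A_j=C$ for all $i\ne j$. $f(w,k)$ denotes the maximum size of a $w$-uniform family containing no $k$-sunflower. For integers $D,q\ge1$, $\operatorname{CH}(D,q)$ is the maximum number of edges in a graph with maximum degree at most $D$ and matching number at most $q$; by the Chvátal–Hanson theorem (a known result), $$\operatorname{CH}(D,q)=Dq+\left\lfloor\tfrac D2\right\rfloor\left\lfloor\frac{q}{\lceil D/2\rceil}\right\rfloor .$$ -}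

module Defs where

open import Data.Bool.Properties using () renaming (_≟_ to _≟ᵇ_)
open import Data.Fin using (Fin; zero; suc; punchIn)
open import Data.Fin.Properties using (all?; pigeonhole; ¬∀⟶∃¬; <⇒≢) renaming (_≟_ to _≟ᶠ_)
open import Data.Fin.Subset using (Subset; inside; outside; _∈_; _∉_; _∩_; ⊥; ∣_∣)
open import Data.Fin.Subset.Properties using (_∈?_; anySubset?; ∩-idem; ∣⊥∣≡0; x∈p∩q⁻; ⊥⊆; ⊆-antisym)
open import Data.List as List using (List; []; _∷_; length; map; filter; take; _++_)
open import Data.List.Membership.Propositional using () renaming (_∈_ to _∈ˡ_)
open import Data.List.Membership.Propositional.Properties using (∈-map⁺; ∈-map⁻; ∈-filter⁻; ∈-++⁺ˡ; ∈-++⁺ʳ)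
open import Data.List.Properties using (length-map; length-++; length-take)
open import Data.List.Relation.Unary.All as All using (All; []; _∷_)
import Data.List.Relation.Unary.All.Properties as All
open import Data.List.Relation.Unary.AllPairs as AllPairs using (AllPairs; []; _∷_; allPairs?)
import Data.List.Relation.Unary.AllPairs.Properties as AllPairs
open import Data.List.Relation.Unary.Any as Any using (Any; here; there; index)
import Data.List.Relation.Unary.Any.Properties as Any
open import Data.List.Relation.Unary.Unique.Propositional using (Unique)
open import Data.Nat using (ℕ; zero; suc; _+_; _*_; _∸_; _⊔_; _≤_; _<_; _≤?_; z≤n; s≤s; NonZero)
open import Data.Nat.Properties using (≤-refl; ≤-reflexive; ≤-trans; ≤-pred; ≤∧≢⇒<; ≰⇒>; m∸n+n≡m; suc-injective; +-mono-≤; +-suc; *-monoˡ-≤; m≤n⇒m≤1+n; m≤n⇒m⊓n≡m; 1+n≰n; _≟_)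
open import Data.Product using (∃; ∃-syntax; _×_; _,_; proj₁; proj₂)
open import Data.Vec using (Vec; []; _∷_; tail; lookup; removeAt; insertAt; _[_]≔_)
open import Data.Vec.Base using (_[_]=_; here; there)
open import Data.Vec.Properties using (≡-dec; []=⇒lookup; lookup⇒[]=; []≔-idempotent; []≔-lookup; insertAt-removeAt; insertAt-punchIn)
open import Function using (_∘_)
open import Relation.Binary.PropositionalEquality using (_≡_; _≢_; refl; sym; trans; cong; cong₂; subst)
open import Relation.Nullary using (Dec; yes; no; ¬_; ¬?; contradiction; _×-dec_)
open import Relation.Nullary.Decidable using (map′)

-- A finite family of distinct sets is a duplicate-free list of subsets of some
-- ground set Fin n; the ground set is always left free to vary.

IsUniformFamily : ℕ → ∀ {n} → List (Subset n) → Set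
IsUniformFamily w F = Unique F × All (λ A → ∣ A ∣ ≡ w) F

-- By symmetry of ∩, AllPairs (positions i < j) covers all i ≢ j.
HasCore : ∀ {n} → List (Subset n) → Subset n → Set
HasCore S C = AllPairs (λ A B → A ∩ B ≡ C) S

IsSunflower : ∀ {n} → List (Subset n) → Set
IsSunflower S = Unique S × ∃[ C ] HasCore S C

SunflowerFree : ℕ → ∀ {n} → List (Subset n) → Set
SunflowerFree k F = ¬ (∃[ S ] length S ≡ k × All (_∈ˡ F) S × IsSunflower S)

-- A finite simple graph on the vertex set Fin n is given by its edge set,
-- a duplicate-free list of two-element sets.
IsGraph : ∀ {n} → List (Subset n) → Set
IsGraph E = IsUniformFamily 2 E

degree : ∀ {n} → List (Subset n) → Fin n → ℕ
degree E v = length (filter (v ∈?_) E)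

MaxDegree≤ : ℕ → ∀ {n} → List (Subset n) → Set
MaxDegree≤ D E = ∀ v → degree E v ≤ D

Disjoint : ∀ {n} → Subset n → Subset n → Set
Disjoint A B = A ∩ B ≡ ⊥

-- Distinctness of the edges in a matching follows, edges being nonempty.
IsMatching : ∀ {n} → List (Subset n) → List (Subset n) → Set
IsMatching E M = All (_∈ˡ E) M × AllPairs Disjoint M

MatchingNumber≤ : ℕ → ∀ {n} → List (Subset n) → Set
MatchingNumber≤ q E = ∀ M → IsMatching E M → length M ≤ q

SizeOf : (∀ {n} → List (Subset n) → Set) → ℕ → Set
SizeOf Q m = ∃[ n ] ∃[ F ] length F ≡ m × Q {n} F

IsMaximum : (ℕ → Set) → ℕ → Set
IsMaximum P m = P m × (∀ n → P n → n ≤ m)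

UniformSunflowerFree : ℕ → ℕ → ∀ {n} → List (Subset n) → Set
UniformSunflowerFree w k F = IsUniformFamily w F × SunflowerFree k F

BoundedGraph : ℕ → ℕ → ∀ {n} → List (Subset n) → Set
BoundedGraph D q E = IsGraph E × MaxDegree≤ D E × MatchingNumber≤ q E

-- This module serves only to show that the two maxima f and CH below exist: the sizes in question are bounded, and each size is
-- decidable because its witnesses can be moved to a ground set of bounded size.
module Existence where

  private variable
    n n′ w k m : ℕ

  _≟ˢ_ : (A B : Subset n) → Dec (A ≡ B)
  _≟ˢ_ = ≡-dec _≟ᵇ_

  allPairs-map : ∀ {X Y : Set} {P : X → Set} {R : X → X → Set} {R′ : Y → Y → Set}
                 (g : X → Y) → (∀ {x y} → P x → P y → R x y → R′ (g x) (g y)) →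
                 ∀ {xs} → All P xs → AllPairs R xs → AllPairs R′ (map g xs)
  allPairs-map g h [] [] = []
  allPairs-map g h (p ∷ ps) (r ∷ rs) =
    All.map⁺ (All.zipWith (λ (q , s) → h p q s) (ps , r)) ∷ allPairs-map g h ps rs

  -- Moving families along φ, with partial inverse ψ.

  module _ {F : List (Subset n)} (φ : Subset n → Subset n′) (ψ : Subset n′ → Subset n)
           (ψφ : ∀ {A} → A ∈ˡ F → ψ (φ A) ≡ A) where

    pull : ∀ {B} → B ∈ˡ map φ F → ψ B ∈ˡ F × φ (ψ B) ≡ B
    pull B∈ with ∈-map⁻ φ B∈
    ... | A , A∈F , refl = subst (_∈ˡ F) (sym (ψφ A∈F)) A∈F , cong φ (ψφ A∈F)

    pull-inj : ∀ {B B′} → B ∈ˡ map φ F → B′ ∈ˡ map φ F → B ≢ B′ → ψ B ≢ ψ B′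
    pull-inj B∈ B′∈ B≢B′ eq =
      B≢B′ (trans (sym (proj₂ (pull B∈))) (trans (cong φ eq) (proj₂ (pull B′∈))))

    push-unique : Unique F → Unique (map φ F)
    push-unique u = allPairs-map φ
      (λ A∈ B∈ A≢B eq → A≢B (trans (sym (ψφ A∈)) (trans (cong ψ eq) (ψφ B∈))))
      (All.tabulate (λ A∈ → A∈)) u

    push-free : (∀ A B → ψ (A ∩ B) ≡ ψ A ∩ ψ B) →
                SunflowerFree k F → SunflowerFree k (map φ F)
    push-free ψ∩ free (S , len , S⊆ , u , C , core) = free
      ( map ψ S , trans (length-map ψ S) len
      , All.map⁺ (All.map (proj₁ ∘ pull) S⊆)
      , allPairs-map ψ pull-inj S⊆ u
      , ψ C
      , AllPairs.map⁺ (AllPairs.map (λ {A} {B} eq → trans (sym (ψ∩ A B)) (cong ψ eq)) core))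

    push-matching : ∀ {q} → (∀ A B → ψ (A ∩ B) ≡ ψ A ∩ ψ B) → ψ ⊥ ≡ ⊥ →
                    MatchingNumber≤ q F → MatchingNumber≤ q (map φ F)
    push-matching ψ∩ ψ⊥ ν≤ M (M⊆ , dis) = subst (_≤ _) (length-map ψ M) (ν≤ (map ψ M)
      ( All.map⁺ (All.map (proj₁ ∘ pull) M⊆)
      , AllPairs.map⁺ (AllPairs.map
          (λ {A} {B} eq → trans (sym (ψ∩ A B)) (trans (cong ψ eq) ψ⊥)) dis)))

  push-degree : (φ : Subset n → Subset n′) (F : List (Subset n)) (v : Fin n) (v′ : Fin n′) →
                (∀ A → v′ ∈ φ A → v ∈ A) → degree (map φ F) v′ ≤ degree F v
  push-degree φ [] v v′ h = z≤n
  push-degree φ (A ∷ F) v v′ h with v′ ∈? φ A | v ∈? A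
  ... | yes _ | yes _ = s≤s (push-degree φ F v v′ h)
  ... | yes p | no ¬p = contradiction (h A p) ¬p
  ... | no _  | yes _ = m≤n⇒m≤1+n (push-degree φ F v v′ h)
  ... | no _  | no _  = push-degree φ F v v′ h

  degree-zero : (φ : Subset n → Subset n′) (F : List (Subset n)) (v′ : Fin n′) →
                (∀ A → v′ ∉ φ A) → degree (map φ F) v′ ≡ 0
  degree-zero φ [] v′ h = refl
  degree-zero φ (A ∷ F) v′ h with v′ ∈? φ A
  ... | yes p = contradiction p (h A)
  ... | no _  = degree-zero φ F v′ h

  -- φ deletes an element x of each set, φ drops an unused point x from the
  -- ground set, or φ adds a fresh point to the ground set.

  delete-restore : ∀ {A : Subset n} x → x ∈ A → (A [ x ]≔ outside) [ x ]≔ inside ≡ A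
  delete-restore {A = A} x x∈A = trans ([]≔-idempotent A x)
    (trans (cong (A [ x ]≔_) (sym ([]=⇒lookup x∈A))) ([]≔-lookup A x))

  restore-∩ : ∀ (x : Fin n) A B → (A ∩ B) [ x ]≔ inside ≡ (A [ x ]≔ inside) ∩ (B [ x ]≔ inside)
  restore-∩ zero    (a ∷ A) (b ∷ B) = refl
  restore-∩ (suc x) (a ∷ A) (b ∷ B) = cong (_ ∷_) (restore-∩ x A B)

  ∣delete∣ : ∀ {A : Subset n} {x} → x ∈ A → suc ∣ A [ x ]≔ outside ∣ ≡ ∣ A ∣
  ∣delete∣ here = refl
  ∣delete∣ {A = inside  ∷ _} (there p) = cong suc (∣delete∣ p)
  ∣delete∣ {A = outside ∷ _} (there p) = ∣delete∣ p

  ∉⇒outside : ∀ {A : Subset n} x → x ∉ A → lookup A x ≡ outside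
  ∉⇒outside {A = A} x x∉A with lookup A x in eq
  ... | inside  = contradiction (lookup⇒[]= x A eq) x∉A
  ... | outside = refl

  drop-insert : ∀ {A : Subset (suc n)} x → x ∉ A → insertAt (removeAt A x) x outside ≡ A
  drop-insert {A = A} x x∉A =
    trans (cong (insertAt (removeAt A x) x) (sym (∉⇒outside x x∉A))) (insertAt-removeAt A x)

  insert-∩ : ∀ (x : Fin (suc n)) A B →
             insertAt (A ∩ B) x outside ≡ insertAt A x outside ∩ insertAt B x outside
  insert-∩ zero    A       B       = refl
  insert-∩ (suc x) (a ∷ A) (b ∷ B) = cong (_ ∷_) (insert-∩ x A B)

  insert-⊥ : ∀ (x : Fin (suc n)) → insertAt ⊥ x outside ≡ ⊥
  insert-⊥ zero = refl
  insert-⊥ {n = suc n} (suc x) = cong (outside ∷_) (insert-⊥ x)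

  ∣insert∣ : ∀ (A : Subset n) x → ∣ insertAt A x outside ∣ ≡ ∣ A ∣
  ∣insert∣ A             zero    = refl
  ∣insert∣ (inside  ∷ A) (suc x) = cong suc (∣insert∣ A x)
  ∣insert∣ (outside ∷ A) (suc x) = ∣insert∣ A x

  removeAt-punchIn : ∀ {X : Set} (A : Vec X (suc n)) x (v : Fin n) →
                     lookup (removeAt A x) v ≡ lookup A (punchIn x v)
  removeAt-punchIn A x v = trans (sym (insertAt-punchIn (removeAt A x) x (lookup A x) v))
    (cong (λ B → lookup B (punchIn x v)) (insertAt-removeAt A x))

  ∈-drop : ∀ (A : Subset (suc n)) x (v : Fin n) → v ∈ removeAt A x → punchIn x v ∈ A
  ∈-drop A x v v∈ = lookup⇒[]= _ A (trans (sym (removeAt-punchIn A x v)) ([]=⇒lookup v∈))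

  tail-∩ : ∀ (A B : Subset (suc n)) → tail (A ∩ B) ≡ tail A ∩ tail B
  tail-∩ (_ ∷ _) (_ ∷ _) = refl

  -- Finite search.

  anyList? : ∀ m {P : List (Subset n) → Set} → (∀ F → Dec (P F)) →
             Dec (∃[ F ] length F ≡ m × P F)
  anyList? zero P? = map′ (λ p → [] , refl , p) (λ { ([] , _ , p) → p }) (P? [])
  anyList? (suc m) P? = map′
    (λ (A , F , eq , p) → A ∷ F , cong suc eq , p)
    (λ { (A ∷ F , eq , p) → A , F , suc-injective eq , p })
    (anySubset? (λ A → anyList? m (λ F → P? (A ∷ F))))

  unique? : (F : List (Subset n)) → Dec (Unique F)
  unique? = allPairs? (λ A B → ¬? (A ≟ˢ B))

  uniform? : ∀ w (F : List (Subset n)) → Dec (IsUniformFamily w F)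
  uniform? w F = unique? F ×-dec All.all? (λ A → ∣ A ∣ ≟ w) F

  members? : (F S : List (Subset n)) → Dec (All (_∈ˡ F) S)
  members? F = All.all? (λ A → Any.any? (A ≟ˢ_) F)

  free? : ∀ k (F : List (Subset n)) → Dec (SunflowerFree k F)
  free? k F = ¬? (anyList? k (λ S → members? F S ×-dec
    (unique? S ×-dec anySubset? (λ C → allPairs? (λ A B → (A ∩ B) ≟ˢ C) S))))

  length-take≡ : ∀ {X : Set} k (xs : List X) → k ≤ length xs → length (take k xs) ≡ k
  length-take≡ k xs le = trans (length-take k xs) (m≤n⇒m⊓n≡m le)

  matching? : ∀ q (E : List (Subset n)) → Dec (MatchingNumber≤ q E)
  matching? q E = map′ to from
    (¬? (anyList? (suc q) (λ M → members? E M ×-dec allPairs? (λ A B → (A ∩ B) ≟ˢ ⊥) M)))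
    where
    to : ¬ (∃[ M ] length M ≡ suc q × IsMatching E M) → MatchingNumber≤ q E
    to none M (M⊆ , dis) with length M ≤? q
    ... | yes le = le
    ... | no ¬le = contradiction
      ( take (suc q) M , length-take≡ (suc q) M (≰⇒> ¬le)
      , All.take⁺ (suc q) M⊆ , AllPairs.take⁺ (suc q) dis) none
    from : MatchingNumber≤ q E → ¬ (∃[ M ] length M ≡ suc q × IsMatching E M)
    from ν≤ (M , len , match) = 1+n≰n (subst (_≤ q) len (ν≤ M match))

  -- Points covered by a family.

  elements : Subset n → List (Fin n)
  elements []            = []
  elements (inside  ∷ A) = zero ∷ map suc (elements A)
  elements (outside ∷ A) = map suc (elements A)

  length-elements : (A : Subset n) → length (elements A) ≡ ∣ A ∣
  length-elements []            = refl
  length-elements (inside  ∷ A) = cong suc (trans (length-map suc (elements A)) (length-elements A))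
  length-elements (outside ∷ A) = trans (length-map suc (elements A)) (length-elements A)

  ∈-elements : ∀ {x} {A : Subset n} → x ∈ A → x ∈ˡ elements A
  ∈-elements here = here refl
  ∈-elements {A = inside  ∷ _} (there p) = there (∈-map⁺ suc (∈-elements p))
  ∈-elements {A = outside ∷ _} (there p) = ∈-map⁺ suc (∈-elements p)

  points : List (Subset n) → List (Fin n)
  points []      = []
  points (A ∷ F) = elements A ++ points F

  length-points : ∀ {F : List (Subset n)} → All (λ A → ∣ A ∣ ≡ w) F →
                  length (points F) ≡ length F * w
  length-points [] = refl
  length-points {F = A ∷ F} (refl ∷ ps) = trans (length-++ (elements A))
    (cong₂ _+_ (length-elements A) (length-points ps))

  ∈-points : ∀ {x} {A : Subset n} {F} → A ∈ˡ F → x ∈ A → x ∈ˡ points F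
  ∈-points (here refl) x∈ = ∈-++⁺ˡ (∈-elements x∈)
  ∈-points {F = B ∷ _} (there A∈) x∈ = ∈-++⁺ʳ (elements B) (∈-points A∈ x∈)

  listed? : (xs : List (Fin n)) (x : Fin n) → Dec (x ∈ˡ xs)
  listed? xs x = Any.any? (x ≟ᶠ_) xs

  fresh : (xs : List (Fin n)) → length xs < n → ∃[ x ] ¬ (x ∈ˡ xs)
  fresh {n} xs lt = ¬∀⟶∃¬ n (_∈ˡ xs) (listed? xs) λ every →
    let i , j , i<j , eq = pigeonhole lt (index ∘ every)
    in <⇒≢ i<j (trans (Any.lookup-index (every i))
         (trans (cong (List.lookup xs) eq) (sym (Any.lookup-index (every j)))))

  -- Existence of the maximum for a bounded property of w-uniform families
  -- that is insensitive to changes of the ground set.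

  module _ (P : ℕ → Set) (P? : ∀ m → Dec (P m)) (P0 : P 0) where

    search : ∀ b → (∀ m → P m → m ≤ b) → ∃[ m ] IsMaximum P m
    search zero    ub = 0 , P0 , ub
    search (suc b) ub with P? (suc b)
    ... | yes p = suc b , p , ub
    ... | no ¬p = search b λ m p →
      ≤-pred (≤∧≢⇒< (ub m p) λ eq → ¬p (subst P eq p))

  module _ (Q : ∀ {n} → List (Subset n) → Set)
           (Q? : ∀ {n} (F : List (Subset n)) → Dec (Q F))
           (w : ℕ)
           (sizes : ∀ {n} {F : List (Subset n)} → Q F → All (λ A → ∣ A ∣ ≡ w) F)
           (pad : ∀ {n} {F : List (Subset n)} → Q F → Q (map (outside ∷_) F))
           (drop : ∀ {n} {F : List (Subset (suc n))} x → (∀ {A} → A ∈ˡ F → x ∉ A) →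
                   Q F → Q (map (λ A → removeAt A x) F))
           where

    OnGround : ℕ → ℕ → Set
    OnGround N m = ∃[ F ] length F ≡ m × Q {N} F

    grow : OnGround n m → OnGround (suc n) m
    grow (F , len , q) = map (outside ∷_) F , trans (length-map _ F) len , pad q

    shrink : m * w < suc n → OnGround (suc n) m → OnGround n m
    shrink lt (F , refl , q) =
      let x , x∉ = fresh (points F) (subst (_< _) (sym (length-points (sizes q))) lt)
      in map (λ A → removeAt A x) F , length-map _ F
         , drop x (λ A∈ x∈A → x∉ (∈-points A∈ x∈A)) q

    growBy : ∀ d → OnGround n m → OnGround (d + n) m
    growBy zero    g = g
    growBy (suc d) g = grow (growBy d g)

    shrinkTo : ∀ n → OnGround n m → OnGround (m * w) m
    shrinkTo {m} n g with n ≤? m * w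
    shrinkTo {m} n g | yes le = subst (λ N → OnGround N m)
      (m∸n+n≡m le) (growBy (m * w ∸ n) g)
    shrinkTo zero g | no ¬le = contradiction z≤n ¬le
    shrinkTo (suc n) g | no ¬le = shrinkTo n (shrink (≰⇒> ¬le) g)

    size? : ∀ m → Dec (SizeOf Q m)
    size? m = map′ (m * w ,_) (λ (n , g) → shrinkTo n g) (anyList? m Q?)

    maximum : Q {0} [] → ∀ b → (∀ {n} {F : List (Subset n)} → Q F → length F ≤ b) →
              ∃[ m ] IsMaximum (SizeOf Q) m
    maximum q b ub = search (SizeOf Q) size? (0 , [] , refl , q) b
      λ { m (n , F , refl , q′) → ub q′ }

  -- The bounds: a maximal disjoint subfamily meets every member.

  empty⇒⊥ : ∀ {A : Subset n} → (∀ {x} → x ∉ A) → A ≡ ⊥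
  empty⇒⊥ h = ⊆-antisym (λ x∈ → contradiction x∈ h) ⊥⊆

  meet? : (A : Subset n) (xs : List (Fin n)) → Dec (Any (_∈ A) xs)
  meet? A = Any.any? (_∈? A)

  nonempty : ∀ (A : Subset n) → ∣ A ∣ ≡ suc w → Any (_∈ A) (elements A)
  nonempty (inside  ∷ A) eq = here here
  nonempty (outside ∷ A) eq = Any.map⁺ (Any.map there (nonempty A eq))

  greedy : (F : List (Subset n)) → All (λ A → ∣ A ∣ ≡ suc w) F →
           ∃[ M ] All (_∈ˡ F) M × AllPairs Disjoint M × All (λ A → Any (_∈ A) (points M)) F
  greedy [] [] = [] , [] , [] , []
  greedy (A ∷ F) (p ∷ ps) with greedy F ps
  ... | M , M⊆ , dis , cov with meet? A (points M)
  ...   | yes hit = M , All.map there M⊆ , dis , hit ∷ cov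
  ...   | no miss = A ∷ M , here refl ∷ All.map there M⊆
      , All.tabulate (λ {B} B∈M → empty⇒⊥ λ {x} x∈ →
          let x∈A , x∈B = x∈p∩q⁻ A B x∈
          in miss (Any.map (λ { refl → x∈A }) (∈-points B∈M x∈B))) ∷ dis
      , Any.++⁺ˡ (nonempty A p) ∷ All.map (Any.++⁺ʳ (elements A)) cov

  split : ∀ (F : List (Subset n)) x →
          length F ≡ degree F x + length (filter (λ A → ¬? (x ∈? A)) F)
  split [] x = refl
  split (A ∷ F) x with x ∈? A
  ... | yes _ = cong suc (split F x)
  ... | no _  = trans (cong suc (split F x)) (sym (+-suc _ _))

  degree-filter : ∀ (F : List (Subset n)) x y →
                  degree (filter (λ A → ¬? (x ∈? A)) F) y ≤ degree F y
  degree-filter [] x y = z≤n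
  degree-filter (A ∷ F) x y with x ∈? A
  degree-filter (A ∷ F) x y | yes _ with y ∈? A
  ... | yes _ = m≤n⇒m≤1+n (degree-filter F x y)
  ... | no _  = degree-filter F x y
  degree-filter (A ∷ F) x y | no _ with y ∈? A
  ... | yes _ = s≤s (degree-filter F x y)
  ... | no _  = degree-filter F x y

  cover : ∀ (F : List (Subset n)) b → (∀ x → degree F x ≤ b) →
          ∀ xs → All (λ A → Any (_∈ A) xs) F → length F ≤ length xs * b
  cover []      b deg []       cov = z≤n
  cover (A ∷ F) b deg []       (() ∷ _)
  cover F       b deg (x ∷ xs) cov = subst (_≤ _) (sym (split F x))
    (+-mono-≤ (deg x) (cover F′ b (λ y → ≤-trans (degree-filter F x y) (deg y)) xs
      (All.zipWith (λ { (x∉ , here x∈)  → contradiction x∈ x∉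
                      ; (_  , there xs∈) → xs∈ })
        (All.all-filter (λ A → ¬? (x ∈? A)) F , All.filter⁺ (λ A → ¬? (x ∈? A)) cov))))
    where F′ = filter (λ A → ¬? (x ∈? A)) F

  disjoint⇒unique : ∀ {M : List (Subset n)} → All (λ A → ∣ A ∣ ≡ suc w) M →
                    AllPairs Disjoint M → Unique M
  disjoint⇒unique [] [] = []
  disjoint⇒unique {n} {M = A ∷ _} (p ∷ ps) (d ∷ ds) =
    All.map (λ { A∩B refl → contradiction
      (trans (sym p) (trans (cong ∣_∣ (trans (sym (∩-idem A)) A∩B)) (∣⊥∣≡0 n))) λ () }) d
    ∷ disjoint⇒unique ps ds

  free⇒< : ∀ {F S : List (Subset n)} → SunflowerFree (suc k) F →
           All (_∈ˡ F) S → IsSunflower S → length S ≤ k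
  free⇒< {k = k} {S = S} free S⊆ (u , C , core) with length S ≤? k
  ... | yes le = le
  ... | no ¬le = contradiction
    ( take (suc k) S , length-take≡ (suc k) S (≰⇒> ¬le) , All.take⁺ (suc k) S⊆
    , AllPairs.take⁺ (suc k) u , C , AllPairs.take⁺ (suc k) core) free

  all-∈ : ∀ {P : Subset n → Set} {F S : List (Subset n)} → All P F → All (_∈ˡ F) S → All P S
  all-∈ ps = All.map (All.lookup ps)

  size0⇒⊥ : ∀ (A : Subset n) → ∣ A ∣ ≡ 0 → A ≡ ⊥
  size0⇒⊥ []            eq = refl
  size0⇒⊥ (outside ∷ A) eq = cong (outside ∷_) (size0⇒⊥ A eq)

  sunflowerBound : ℕ → ℕ → ℕ
  sunflowerBound zero    k = 1
  sunflowerBound (suc w) k = k * suc w * sunflowerBound w k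

  sunflower-lemma : ∀ w k {F : List (Subset n)} → UniformSunflowerFree w (suc k) F →
                    length F ≤ sunflowerBound w k
  sunflower-lemma zero k {[]}        _ = z≤n
  sunflower-lemma zero k {_ ∷ []}    _ = ≤-refl
  sunflower-lemma zero k {A ∷ B ∷ _} ((((A≢B ∷ _) ∷ _) , (p ∷ q ∷ _)) , _) =
    contradiction (trans (size0⇒⊥ A p) (sym (size0⇒⊥ B q))) A≢B
  sunflower-lemma {n} (suc w) k {F} ((u , sz) , free) with greedy F sz
  ... | M , M⊆ , dis , cov = ≤-trans (cover F (sunflowerBound w k) link (points M) cov)
    (*-monoˡ-≤ (sunflowerBound w k)
      (≤-trans (≤-reflexive (length-points szM))
        (*-monoˡ-≤ (suc w) (free⇒< free M⊆ (disjoint⇒unique szM dis , ⊥ , dis)))))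
    where
    szM = all-∈ sz M⊆
    link : ∀ x → degree F x ≤ sunflowerBound w k
    link x = subst (_≤ _) (length-map φ Fₓ) (sunflower-lemma w k
      (((push-unique φ ψ ψφ (AllPairs.filter⁺ (x ∈?_) u))
        , All.map⁺ (All.zipWith (λ (x∈ , s) → suc-injective (trans (∣delete∣ x∈) s))
            (All.all-filter (x ∈?_) F , All.filter⁺ (x ∈?_) sz)))
      , push-free φ ψ ψφ (restore-∩ x) λ (S , len , S⊆ , sun) →
          free (S , len , All.map (proj₁ ∘ ∈-filter⁻ (x ∈?_)) S⊆ , sun)))
      where
      Fₓ = filter (x ∈?_) F
      φ ψ : Subset n → Subset n
      φ A = A [ x ]≔ outside
      ψ A = A [ x ]≔ inside
      ψφ : ∀ {A} → A ∈ˡ Fₓ → ψ (φ A) ≡ A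
      ψφ A∈ = delete-restore x (proj₂ (∈-filter⁻ (x ∈?_) {xs = F} A∈))

  graph-bound : ∀ D q {E : List (Subset n)} → BoundedGraph D q E → length E ≤ q * 2 * D
  graph-bound D q {E} ((u , sz) , deg , ν≤) with greedy E sz
  ... | M , M⊆ , dis , cov = ≤-trans (cover E D deg (points M) cov)
    (*-monoˡ-≤ D (≤-trans (≤-reflexive (length-points (all-∈ sz M⊆)))
      (*-monoˡ-≤ 2 (ν≤ M (M⊆ , dis)))))

  pad-uniform : ∀ {F : List (Subset n)} → IsUniformFamily w F → IsUniformFamily w (map (outside ∷_) F)
  pad-uniform (u , sz) = push-unique (outside ∷_) tail (λ _ → refl) u , All.map⁺ sz

  drop-uniform : ∀ {F : List (Subset (suc n))} x → (∀ {A} → A ∈ˡ F → x ∉ A) →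
                 IsUniformFamily w F → IsUniformFamily w (map (λ A → removeAt A x) F)
  drop-uniform {F = F} x x∉ (u , sz) =
      push-unique _ (λ A → insertAt A x outside) (drop-insert x ∘ x∉) u
    , All.map⁺ (All.tabulate λ {A} A∈ →
        trans (trans (sym (∣insert∣ (removeAt A x) x)) (cong ∣_∣ (drop-insert x (x∉ A∈))))
              (All.lookup sz A∈))

  f-maximum : ∀ w k → ∃[ m ] IsMaximum (SizeOf (UniformSunflowerFree w (suc k))) m
  f-maximum w k = maximum (UniformSunflowerFree w (suc k))
    (λ F → uniform? w F ×-dec free? (suc k) F) w
    (proj₂ ∘ proj₁)
    (λ (uf , free) → pad-uniform uf , push-free (outside ∷_) tail (λ _ → refl) tail-∩ free)
    (λ x x∉ (uf , free) → drop-uniform x x∉ uf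
      , push-free _ (λ A → insertAt A x outside) (drop-insert x ∘ x∉) (insert-∩ x) free)
    (([] , []) , λ { (A ∷ S , _ , (() ∷ _) , _) })
    (sunflowerBound w k) (sunflower-lemma w k)

  CH-maximum : ∀ D q → ∃[ m ] IsMaximum (SizeOf (BoundedGraph D q)) m
  CH-maximum D q = maximum (BoundedGraph D q)
    (λ E → uniform? 2 E ×-dec (all? (λ v → degree E v ≤? D) ×-dec matching? q E)) 2
    (proj₂ ∘ proj₁)
    (λ {_} {E} (g , deg , ν≤) → pad-uniform g
      , (λ { zero    → subst (_≤ D) (sym (degree-zero (outside ∷_) E zero λ _ ())) z≤n
           ; (suc v) → ≤-trans (push-degree (outside ∷_) E v (suc v) λ { _ (there p) → p }) (deg v) })
      , push-matching (outside ∷_) tail (λ _ → refl) tail-∩ refl ν≤)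
    (λ {_} {E} x x∉ (g , deg , ν≤) → drop-uniform x x∉ g
      , (λ v → ≤-trans (push-degree _ E (punchIn x v) v λ A → ∈-drop A x v) (deg (punchIn x v)))
      , push-matching _ (λ A → insertAt A x outside) (drop-insert x ∘ x∉)
          (insert-∩ x) (insert-⊥ x) ν≤)
    (([] , []) , (λ ()) , λ { [] _ → z≤n ; (A ∷ M) ((() ∷ _) , _) })
    (q * 2 * D) (graph-bound D q)

-- f and CH are characterised by f-isMaximum and CH-isMaximum.
opaque

  -- For k = 0 there is no sunflower-free family (the empty collection is a
  -- 0-sunflower), and the value 0 is a convention.
  f : ℕ → ℕ → ℕ
  f w zero    = 0
  f w (suc k) = proj₁ (Existence.f-maximum w k)

  f-isMaximum : ∀ w k .{{_ : NonZero k}} → IsMaximum (SizeOf (UniformSunflowerFree w k)) (f w k)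
  f-isMaximum w (suc k) = proj₂ (Existence.f-maximum w k)

  CH : ℕ → ℕ → ℕ
  CH D q = proj₁ (Existence.CH-maximum D q)

  CH-isMaximum : ∀ D q → IsMaximum (SizeOf (BoundedGraph D q)) (CH D q)
  CH-isMaximum D q = proj₂ (Existence.CH-maximum D q)

h : ℕ → ℕ
h k = CH (k ∸ 1) (k ∸ 1)

c : ℕ → ℕ
c k = CH (k ∸ 1) (k ∸ 2) ⊔ 3 * (k ∸ 1)

-- A 2-uniform family is k-sunflower-free iff, as a graph, it has maximum degree and matching number
-- at most D = k - 1, whence h k = f 2 k.
--
-- Let M be a maximum matching in a 3-uniform k-sunflower-free family F, so that |M| ≤ D.  Every A in F
-- meets ⋃M.  Counting each incidence of A with a point of ⋃M once, and once more when it is the only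
-- one (A is then private to that point), A counts at least twice, and three times when A ∈ M; hence
-- 2|F| + |M| is at most the sum over x ∈ ⋃M of deg x plus the number of sets private to x.  Degrees are
-- at most f 2 k, since links are sunflower-free.  For e ∈ M, the three graphs obtained by deleting x ∈ e
-- from the sets private to x have maximum degree ≤ D; adding e to a matching in one of them gives a
-- sunflower with core {x}, so their matching number is ≤ D - 1; and they are pairwise cross-intersecting,
-- as otherwise e could be exchanged for two sets.  If two of them are empty, the third has at most
-- CH(D, D-1) edges.  Otherwise they have at most 3D edges together: if |G| > D and H is cross-intersecting
-- with G and nonempty, then |G| + 2|H| ≤ 3D.

module Submission where

open import Defs
open import Data.Fin using (Fin; zero; suc)
open import Data.Fin.Properties using () renaming (_≟_ to _≟ᶠ_; suc-injective to sucᶠ-injective)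
open import Data.Fin.Subset using (Subset; inside; outside; _∈_; _∉_; _⊆_; _∩_; ⊥; ⁅_⁆; ∣_∣)
open import Data.Fin.Subset.Properties using (_∈?_; nonempty?; x∈p∩q⁺; x∈p∩q⁻; p∩q⊆p; p∩q⊆q; ∩-comm; ∩-idem; ∉⊥; ⊆-antisym; x∈⁅x⁆; x∈⁅y⁆⇒x≡y; ∣⁅x⁆∣≡1)
open import Data.List using (List; []; _∷_; _++_; length; map; filter)
open import Data.List.Membership.Propositional using (find; lose) renaming (_∈_ to _∈ˡ_)
open import Data.List.Membership.Propositional.Properties using (∈-∃++; ∈-++⁺ˡ; ∈-++⁺ʳ; ∈-++⁻; ∈-map⁻; ∈-filter⁺; ∈-filter⁻)
open import Data.List.Properties using (length-++; length-map; map-++)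
open import Data.List.Relation.Unary.All as All using (All; []; _∷_)
import Data.List.Relation.Unary.All.Properties as All
open import Data.List.Relation.Unary.AllPairs as AllPairs using (AllPairs; []; _∷_; allPairs?)
import Data.List.Relation.Unary.AllPairs.Properties as AllPairs
open import Data.List.Relation.Unary.Any as Any using (Any; here; there)
open import Data.List.Relation.Unary.Unique.Propositional using (Unique)
import Data.List.Relation.Unary.Unique.Propositional.Properties as Unique
open import Data.Nat using (ℕ; suc; _+_; _*_; _∸_; _⊔_; _≤_; _<_; _≤?_; z≤n; s≤s)
open import Data.Nat.ListAction using (sum)
open import Data.Nat.ListAction.Properties using (sum-++)
open import Data.Nat.Properties
open import Data.Nat.Tactic.RingSolver using (solve-∀)
open import Data.Product using (∃-syntax; _×_; _,_; proj₁; proj₂)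
open import Data.Sum using (_⊎_; inj₁; inj₂)
open import Data.Vec using ([]; _∷_; _[_]≔_)
open import Data.Vec.Base using (here; there)
open import Data.Vec.Properties using ([]≔-minimal)
open import Function using (_∘_)
open import Relation.Binary.PropositionalEquality using (_≡_; _≢_; refl; sym; trans; cong; cong₂; subst)
open import Relation.Nullary using (Dec; yes; no; ¬_; ¬?; contradiction; _×-dec_; _→-dec_)
open Existence using (_≟ˢ_; search; anyList?; members?; elements; length-elements; ∈-elements; points; ∈-points;
  delete-restore; restore-∩; ∣delete∣; push-unique; push-free; pull; split; cover; free⇒<; disjoint⇒unique; all-∈; empty⇒⊥)

private variable
  n w k D : ℕ
  X : Set

-- Duplicate-free lists

unique-⊆-length : {xs ys : List X} → Unique xs → All (_∈ˡ ys) xs → length xs ≤ length ys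
unique-⊆-length [] [] = z≤n
unique-⊆-length {xs = x ∷ xs} (x∉ ∷ u) (x∈ ∷ xs⊆) with ∈-∃++ x∈
... | as , bs , refl = subst (suc (length xs) ≤_)
    (sym (trans (length-++ as) (trans (+-suc _ _) (cong suc (sym (length-++ as))))))
    (s≤s (unique-⊆-length u (All.zipWith skip (x∉ , xs⊆))))
  where
  skip : ∀ {y} → x ≢ y × y ∈ˡ as ++ x ∷ bs → y ∈ˡ as ++ bs
  skip (x≢y , y∈) with ∈-++⁻ as y∈
  ... | inj₁ p            = ∈-++⁺ˡ p
  ... | inj₂ (here y≡x)   = contradiction (sym y≡x) x≢y
  ... | inj₂ (there p)    = ∈-++⁺ʳ as p

subsingleton-length : {xs : List X} → Unique xs → (∀ {x y} → x ∈ˡ xs → y ∈ˡ xs → x ≡ y) → length xs ≤ 1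
subsingleton-length []             eq = z≤n
subsingleton-length (_ ∷ [])       eq = ≤-refl
subsingleton-length ((x≢y ∷ _) ∷ _ ∷ _) eq = contradiction (eq (here refl) (there (here refl))) x≢y

inhabited : {xs : List X} → 1 ≤ length xs → ∃[ x ] x ∈ˡ xs
inhabited {xs = x ∷ _} _ = x , here refl

allPairs-tabulate : {R : X → X → Set} {xs : List X} → Unique xs →
                    (∀ {x y} → x ∈ˡ xs → y ∈ˡ xs → x ≢ y → R x y) → AllPairs R xs
allPairs-tabulate []       r = []
allPairs-tabulate (x∉ ∷ u) r =
  All.tabulate (λ y∈ → r (here refl) (there y∈) (All.lookup x∉ y∈))
  ∷ allPairs-tabulate u (λ x∈ y∈ → r (there x∈) (there y∈))

allPairs-lookup : {R : X → X → Set} → (∀ {x y} → R x y → R y x) → {xs : List X} → AllPairs R xs →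
                  ∀ {x y} → x ∈ˡ xs → y ∈ˡ xs → x ≢ y → R x y
allPairs-lookup s (r ∷ rs) (here refl) (here refl) x≢y = contradiction refl x≢y
allPairs-lookup s (r ∷ rs) (here refl) (there y∈)  x≢y = All.lookup r y∈
allPairs-lookup s (r ∷ rs) (there x∈)  (here refl) x≢y = s (All.lookup r x∈)
allPairs-lookup s (r ∷ rs) (there x∈)  (there y∈)  x≢y = allPairs-lookup s rs x∈ y∈ x≢y

-- Listing the points of sets

∈-elements⁻ : (A : Subset n) → All (_∈ A) (elements A)
∈-elements⁻ []            = []
∈-elements⁻ (inside  ∷ A) = here ∷ All.map⁺ (All.map there (∈-elements⁻ A))
∈-elements⁻ (outside ∷ A) = All.map⁺ (All.map there (∈-elements⁻ A))

elements-unique : (A : Subset n) → Unique (elements A)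
elements-unique []            = []
elements-unique (inside  ∷ A) =
  All.map⁺ (All.universal (λ _ ()) (elements A)) ∷ Unique.map⁺ sucᶠ-injective (elements-unique A)
elements-unique (outside ∷ A) = Unique.map⁺ sucᶠ-injective (elements-unique A)

unique-∈-length : {A : Subset n} {xs : List (Fin n)} → Unique xs → All (_∈ A) xs → length xs ≤ ∣ A ∣
unique-∈-length {A = A} u xs∈ = ≤-trans (unique-⊆-length u (All.map ∈-elements xs∈))
  (≤-reflexive (length-elements A))

∈-points⁻ : ∀ (M : List (Subset n)) {x} → x ∈ˡ points M → ∃[ A ] A ∈ˡ M × x ∈ A
∈-points⁻ (A ∷ M) x∈ with ∈-++⁻ (elements A) x∈
... | inj₁ p = A , here refl , All.lookup (∈-elements⁻ A) p
... | inj₂ p = let B , B∈ , x∈B = ∈-points⁻ M p in B , there B∈ , x∈B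

-- Two-element sets

only-two : ∀ {A : Subset n} {x y z} → ∣ A ∣ ≡ 2 → x ≢ y → x ∈ A → y ∈ A → z ∈ A → z ≡ x ⊎ z ≡ y
only-two {A = A} {x} {y} {z} s x≢y x∈ y∈ z∈ with z ≟ᶠ x | z ≟ᶠ y
... | yes p | _     = inj₁ p
... | no _  | yes q = inj₂ q
... | no p  | no q  = contradiction
  (subst (3 ≤_) s (unique-∈-length ((p ∷ q ∷ []) ∷ (x≢y ∷ []) ∷ [] ∷ []) (z∈ ∷ x∈ ∷ y∈ ∷ []))) 1+n≰n

two-unique : ∀ {A B : Subset n} {x y} → ∣ A ∣ ≡ 2 → ∣ B ∣ ≡ 2 → x ≢ y →
             x ∈ A → y ∈ A → x ∈ B → y ∈ B → A ≡ B
two-unique sA sB x≢y xA yA xB yB = ⊆-antisym (sub sA xA yA xB yB) (sub sB xB yB xA yA)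
  where
  sub : ∀ {A B} → ∣ A ∣ ≡ 2 → _ ∈ A → _ ∈ A → _ ∈ B → _ ∈ B → A ⊆ B
  sub s xA yA xB yB z∈ with only-two s x≢y xA yA z∈
  ... | inj₁ refl = xB
  ... | inj₂ refl = yB

two-elements : (A : Subset n) → ∣ A ∣ ≡ 2 → ∃[ x ] ∃[ y ] x ≢ y × x ∈ A × y ∈ A
two-elements A s with elements A | trans (length-elements A) s | elements-unique A | ∈-elements⁻ A
... | x ∷ y ∷ [] | _ | (x≢y ∷ []) ∷ _ | x∈ ∷ y∈ ∷ [] = x , y , x≢y , x∈ , y∈

other : ∀ {A : Subset n} {x} → ∣ A ∣ ≡ 2 → x ∈ A → ∃[ y ] x ≢ y × y ∈ A
other {A = A} {x} s x∈ with two-elements A s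
... | a , b , a≢b , a∈ , b∈ with x ≟ᶠ a
...   | yes refl = b , a≢b , b∈
...   | no x≢a   = a , x≢a , a∈

-- Sunflower-free graphs as graphs of bounded degree and matching number

free⇒matching : {F : List (Subset n)} → IsUniformFamily (suc w) F → SunflowerFree (suc D) F → MatchingNumber≤ D F
free⇒matching (_ , sz) free M (M⊆ , dis) = free⇒< free M⊆ (disjoint⇒unique (all-∈ sz M⊆) dis , ⊥ , dis)

-- Two distinct edges through `v` share nothing else, so the edges at `v` form a sunflower with core
-- `⁅ v ⁆`; a matching is a sunflower with empty core.
free⇒bounded : {F : List (Subset n)} → UniformSunflowerFree 2 (suc D) F → BoundedGraph D D F
free⇒bounded {F = F} ((u , sz) , free) = (u , sz) , deg , free⇒matching (u , sz) free
  where
  deg : MaxDegree≤ _ F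
  deg v = free⇒< free (All.tabulate (proj₁ ∘ ∈-filter⁻ (v ∈?_)))
    (uv , ⁅ v ⁆ , allPairs-tabulate uv core)
    where
    uv = AllPairs.filter⁺ (v ∈?_) u
    core : ∀ {A B} → A ∈ˡ filter (v ∈?_) F → B ∈ˡ filter (v ∈?_) F → A ≢ B → A ∩ B ≡ ⁅ v ⁆
    core {A} {B} A∈ B∈ A≢B with ∈-filter⁻ (v ∈?_) {xs = F} A∈ | ∈-filter⁻ (v ∈?_) {xs = F} B∈
    ... | A∈F , v∈A | B∈F , v∈B = ⊆-antisym to from
      where
      to : A ∩ B ⊆ ⁅ v ⁆
      to {z} z∈ with z ≟ᶠ v | x∈p∩q⁻ A B z∈
      ... | yes refl | _ = x∈⁅x⁆ z
      ... | no z≢v   | z∈A , z∈B = contradiction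
        (two-unique (All.lookup sz A∈F) (All.lookup sz B∈F) z≢v z∈A v∈A z∈B v∈B) A≢B
      from : ⁅ v ⁆ ⊆ A ∩ B
      from z∈ rewrite x∈⁅y⁆⇒x≡y v z∈ = x∈p∩q⁺ (v∈A , v∈B)

-- A point of the core would lie in all `suc D` petals and have too large a degree; with an empty
-- core the petals form too large a matching.
bounded⇒free : {F : List (Subset n)} → 1 ≤ D → BoundedGraph D D F → UniformSunflowerFree 2 (suc D) F
bounded⇒free {F = F} 1≤D ((u , sz) , deg , mat) = (u , sz) , sunflower
  where
  -- At least two sets are required: for a single set `HasCore` holds with any `C`. This is where
  -- `1 ≤ D` enters.
  in-core : ∀ {S C v} → 2 ≤ length S → HasCore S C → v ∈ C → All (v ∈_) S
  in-core {A ∷ B ∷ S} _ ((refl ∷ core) ∷ _) v∈ =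
    p∩q⊆p A B v∈ ∷ p∩q⊆q A B v∈ ∷ All.map (λ {T} eq → p∩q⊆q A T (subst (_ ∈_) (sym eq) v∈)) core
  in-core {_ ∷ []} (s≤s ()) _ _
  sunflower : SunflowerFree _ F
  sunflower (S , len , S⊆ , uS , C , core) with nonempty? C
  ... | yes (v , v∈) = 1+n≰n (≤-trans (≤-reflexive (sym len)) (≤-trans
    (unique-⊆-length uS (All.zipWith (λ (A∈ , v∈A) → ∈-filter⁺ (v ∈?_) A∈ v∈A)
      (S⊆ , in-core (subst (2 ≤_) (sym len) (s≤s 1≤D)) core v∈))) (deg v)))
  ... | no ∅ = 1+n≰n (≤-trans (≤-reflexive (sym len))
    (mat S (S⊆ , AllPairs.map (λ eq → trans eq (empty⇒⊥ (λ x∈ → ∅ (_ , x∈)))) core)))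

h≡f : 1 ≤ D → h (suc D) ≡ f 2 (suc D)
h≡f {D} 1≤D with CH-isMaximum D D | f-isMaximum 2 (suc D)
... | (n , E , |E| , E-bounded) , E-max | (n′ , F , |F| , F-free) , F-max = ≤-antisym
  (F-max _ (n , E , |E| , bounded⇒free 1≤D E-bounded))
  (E-max _ (n′ , F , |F| , free⇒bounded F-free))

-- Cross-intersecting graphs

Meets : Subset n → Subset n → Set
Meets A B = ∃[ z ] z ∈ A × z ∈ B

Cross : List (Subset n) → List (Subset n) → Set
Cross G H = ∀ {A B} → A ∈ˡ G → B ∈ˡ H → Meets A B

Cross-sym : {G H : List (Subset n)} → Cross G H → Cross H G
Cross-sym cr A∈ B∈ = let z , z∈B , z∈A = cr B∈ A∈ in z , z∈A , z∈B

codegree≤1 : ∀ {L : List (Subset n)} {x y} → IsGraph L → x ≢ y →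
             All (x ∈_) L → All (y ∈_) L → length L ≤ 1
codegree≤1 (u , sz) x≢y xs ys = subsingleton-length u λ A∈ B∈ →
  two-unique (All.lookup sz A∈) (All.lookup sz B∈) x≢y
    (All.lookup xs A∈) (All.lookup ys A∈) (All.lookup xs B∈) (All.lookup ys B∈)

filter-graph : ∀ {P : Subset n → Set} (P? : ∀ A → Dec (P A)) {G} → IsGraph G → IsGraph (filter P? G)
filter-graph P? (u , sz) = AllPairs.filter⁺ P? u , All.filter⁺ P? sz

-- Each edge of `L` joins `p` to one of the two points of `t`, and each such pair is at most one
-- edge. So `L` has at most two edges, and if it has two, both points of `t` are reached.
module Star {L : List (Subset n)} {p r t} (g : IsGraph L) (p∈ : All (p ∈_) L)
            (|t| : ∣ t ∣ ≡ 2) (p∉t : p ∉ t) (r∈t : r ∈ t) (meets : All (Meets t) L) where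

  private
    p≢ : ∀ {z} → z ∈ t → p ≢ z
    p≢ z∈t refl = p∉t z∈t

    with-r : degree L r ≤ 1
    with-r = codegree≤1 (filter-graph (r ∈?_) g) (p≢ r∈t) (All.filter⁺ (r ∈?_) p∈) (All.all-filter (r ∈?_) L)

    without-r : length (filter (λ A → ¬? (r ∈? A)) L) ≤ 1
    without-r with other |t| r∈t
    ... | s , r≢s , s∈t = codegree≤1 (filter-graph r∉? g) (p≢ s∈t) (All.filter⁺ r∉? p∈)
        (All.zipWith in-s (All.all-filter r∉? L , All.filter⁺ r∉? meets))
      where
      r∉? = λ A → ¬? (r ∈? A)
      in-s : ∀ {A} → r ∉ A × Meets t A → s ∈ A
      in-s (r∉ , z , z∈t , z∈A) with only-two |t| r≢s r∈t s∈t z∈t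
      ... | inj₁ refl = contradiction z∈A r∉
      ... | inj₂ refl = z∈A

  length≤2 : length L ≤ 2
  length≤2 = ≤-trans (≤-reflexive (split L r)) (+-mono-≤ with-r without-r)

  edge-to : 2 ≤ length L → ∃[ A ] A ∈ˡ L × r ∈ A
  edge-to 2≤ = let A , A∈ = inhabited 1≤ in A , ∈-filter⁻ (r ∈?_) A∈
    where
    1≤ : 1 ≤ degree L r
    1≤ = +-cancelʳ-≤ 1 1 (degree L r) (≤-trans 2≤ (≤-trans (≤-reflexive (split L r)) (+-monoʳ-≤ _ without-r)))

-- The four disjunctions say that a vertex cover of the 4-cycle with sides `P`, `Q` and `R`, `S` is
-- given; such a cover contains a whole side.
two-covers : ∀ {P Q R S T : Set} → (P → Q → T) → (R → S → T) → P ⊎ R → P ⊎ S → Q ⊎ R → Q ⊎ S → T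
two-covers f g (inj₁ p) _        (inj₁ q) _        = f p q
two-covers f g (inj₁ p) _        (inj₂ r) (inj₁ q) = f p q
two-covers f g (inj₁ p) _        (inj₂ r) (inj₂ s) = g r s
two-covers f g (inj₂ r) (inj₂ s) _        _        = g r s
two-covers f g (inj₂ r) (inj₁ p) _        (inj₁ q) = f p q
two-covers f g (inj₂ r) (inj₁ p) _        (inj₂ s) = g r s

-- Two distinct edges h₁, h₂ of H leave room for at most D + 1 edges of G, and D + 1 edges of G force
-- enough of these to occur that every edge meeting all of G is h₁ or h₂.
module Transversals {G H : List (Subset n)} {D} (g : IsGraph G) (deg : MaxDegree≤ D G)
                    (sz : All (λ A → ∣ A ∣ ≡ 2) H) (cross : Cross G H) (3≤D : 3 ≤ D) (D<G : D < length G) where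

  Conclusion : Subset n → Subset n → Set
  Conclusion h₁ h₂ = length G ≤ suc D × All (_∈ˡ h₁ ∷ h₂ ∷ []) H

  module _ {h₁ h₂} (h₁∈ : h₁ ∈ˡ H) (h₂∈ : h₂ ∈ˡ H) (h₁≢h₂ : h₁ ≢ h₂) where

    private
      sz₁ = All.lookup sz h₁∈
      sz₂ = All.lookup sz h₂∈

    -- Here `h₁` is `pq` and `h₂` is `pr`, so an edge of `G` avoiding `p` must be `qr`. Since `p`
    -- has degree at most `D` and `G` has more than `D` edges, `qr` does occur and `p` has degree at
    -- least `D`.
    adjacent : ∀ {p q r} → p ∈ h₁ → p ∈ h₂ → p ≢ q → q ∈ h₁ → p ≢ r → r ∈ h₂ → Conclusion h₁ h₂
    adjacent {p} {q} {r} p∈₁ p∈₂ p≢q q∈ p≢r r∈ = |G| , All.tabulate among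
      where
      p∉? = λ A → ¬? (p ∈? A)
      rest = filter p∉? G
      q≢r : q ≢ r
      q≢r refl = h₁≢h₂ (two-unique sz₁ sz₂ p≢q p∈₁ q∈ p∈₂ r∈)
      second : ∀ {A t s} → A ∈ˡ G → p ∉ A → t ∈ˡ H → p ≢ s → p ∈ t → s ∈ t → s ∈ A
      second A∈ p∉A t∈ p≢s p∈t s∈t with cross A∈ t∈
      ... | z , z∈A , z∈t with only-two (All.lookup sz t∈) p≢s p∈t s∈t z∈t
      ...   | inj₁ refl = contradiction z∈A p∉A
      ...   | inj₂ refl = z∈A
      rest-∈ : ∀ {A} → A ∈ˡ rest → A ∈ˡ G × q ∈ A × r ∈ A
      rest-∈ A∈ with ∈-filter⁻ p∉? {xs = G} A∈
      ... | A∈G , p∉A = A∈G , second A∈G p∉A h₁∈ p≢q p∈₁ q∈ , second A∈G p∉A h₂∈ p≢r p∈₂ r∈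
      |rest| : length rest ≤ 1
      |rest| = codegree≤1 (filter-graph p∉? g) q≢r
        (All.tabulate (proj₁ ∘ proj₂ ∘ rest-∈)) (All.tabulate (proj₂ ∘ proj₂ ∘ rest-∈))
      |G| : length G ≤ suc D
      |G| = ≤-trans (≤-reflexive (split G p)) (≤-trans (+-mono-≤ (deg p) |rest|) (≤-reflexive (+-comm D 1)))
      D≤deg : D ≤ degree G p
      D≤deg = +-cancelʳ-≤ 1 D _ (≤-trans (≤-reflexive (+-comm D 1))
        (≤-trans D<G (≤-trans (≤-reflexive (split G p)) (+-monoʳ-≤ _ |rest|))))
      1≤rest : 1 ≤ length rest
      1≤rest = +-cancelˡ-≤ D 1 _ (≤-trans (≤-reflexive (+-comm D 1))
        (≤-trans D<G (≤-trans (≤-reflexive (split G p)) (+-monoˡ-≤ _ (deg p)))))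
      among : ∀ {t} → t ∈ˡ H → t ∈ˡ h₁ ∷ h₂ ∷ []
      among {t} t∈ with p ∈? t
      -- By `Star`, an edge avoiding `p` meets all edges of `G` at `p` only if there are at most two
      -- of these, but there are at least `D`, hence at least three.
      ... | no p∉t = contradiction (≤-trans 3≤D (≤-trans D≤deg
          (Star.length≤2 (filter-graph (p ∈?_) g) (All.all-filter (p ∈?_) G) szt p∉t
            (proj₁ (proj₂ (proj₂ (proj₂ (two-elements t szt)))))
            (All.tabulate (λ A∈ → Cross-sym cross t∈ (proj₁ (∈-filter⁻ (p ∈?_) {xs = G} A∈))))))) 1+n≰n
        where szt = All.lookup sz t∈
      -- Such a `t` must also meet the edge `qr`, so it is `pq` or `pr`.
      ... | yes p∈t with inhabited 1≤rest
      ...   | A , A∈ with rest-∈ A∈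
      ...     | A∈G , q∈A , r∈A with cross A∈G t∈
      ...       | z , z∈A , z∈t with only-two (All.lookup (proj₂ g) A∈G) q≢r q∈A r∈A z∈A
      ...         | inj₁ refl = here (two-unique (All.lookup sz t∈) sz₁ p≢q p∈t z∈t p∈₁ q∈)
      ...         | inj₂ refl = there (here (two-unique (All.lookup sz t∈) sz₂ p≢r p∈t z∈t p∈₂ r∈))

    -- The edges of `G` split into those through `x` and those through `x′` but not `x`. Each class
    -- is a star all of whose edges meet `h₂`, so `Star` leaves at most two edges in each.
    edge-between : ∀ {x x′ y} → x ≢ x′ → x ∈ h₁ → x′ ∈ h₁ → ¬ Meets h₁ h₂ → y ∈ h₂ →
                   length G ≤ 4 × ∃[ A ] A ∈ˡ G × x ∈ A × y ∈ A
    edge-between {x} {x′} {y} x≢x′ x∈ x′∈ dis y∈ =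
      ≤-trans (≤-reflexive (split G x)) (+-mono-≤ Gₓ.length≤2 rest≤2) , A , A∈G , x∈A , y∈A
      where
      x∉? = λ A → ¬? (x ∈? A)
      rest = filter x∉? G
      Gₓ = filter (x ∈?_) G
      rest-∈ : ∀ {A} → A ∈ˡ rest → A ∈ˡ G × x ∉ A
      rest-∈ = ∈-filter⁻ x∉? {xs = G}
      Gₓ-∈ : ∀ {A} → A ∈ˡ Gₓ → A ∈ˡ G × x ∈ A
      Gₓ-∈ = ∈-filter⁻ (x ∈?_) {xs = G}
      meets : ∀ {A} → A ∈ˡ G → Meets h₂ A
      meets A∈ = Cross-sym cross h₂∈ A∈
      in-x′ : ∀ {A} → A ∈ˡ rest → x′ ∈ A
      in-x′ A∈ with cross (proj₁ (rest-∈ A∈)) h₁∈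
      ... | z , z∈A , z∈₁ with only-two sz₁ x≢x′ x∈ x′∈ z∈₁
      ...   | inj₁ refl = contradiction z∈A (proj₂ (rest-∈ A∈))
      ...   | inj₂ refl = z∈A
      module Gₓ = Star {L = Gₓ} (filter-graph (x ∈?_) g) (All.tabulate (λ A∈ → proj₂ (Gₓ-∈ A∈))) sz₂
        (λ x∈₂ → dis (x , x∈ , x∈₂)) y∈ (All.tabulate (λ A∈ → meets (proj₁ (Gₓ-∈ A∈))))
      rest≤2 : length rest ≤ 2
      rest≤2 = Star.length≤2 {L = rest} (filter-graph x∉? g) (All.tabulate in-x′) sz₂
        (λ x′∈₂ → dis (x′ , x′∈ , x′∈₂)) y∈ (All.tabulate (λ A∈ → meets (proj₁ (rest-∈ A∈))))
      -- `3 ≤ D < length G` gives at least four edges, at most two of which avoid `x`.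
      2≤deg : 2 ≤ length Gₓ
      2≤deg = +-cancelʳ-≤ 2 2 _ (≤-trans (s≤s 3≤D) (≤-trans D<G
        (≤-trans (≤-reflexive (split G x)) (+-monoʳ-≤ _ rest≤2))))
      edge = Gₓ.edge-to 2≤deg
      A = proj₁ edge
      y∈A = proj₂ (proj₂ edge)
      A∈G = proj₁ (Gₓ-∈ (proj₁ (proj₂ edge)))
      x∈A = proj₂ (Gₓ-∈ (proj₁ (proj₂ edge)))

    -- By `edge-between`, `G` is the 4-cycle of all pairs between `h₁` and `h₂`. Every edge of `H`
    -- is a vertex cover of it, hence one of its two sides.
    disjoint : ∀ {p q r s} → ¬ Meets h₁ h₂ → p ≢ q → p ∈ h₁ → q ∈ h₁ → r ≢ s → r ∈ h₂ → s ∈ h₂ → Conclusion h₁ h₂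
    disjoint {p} {q} {r} {s} dis p≢q p∈ q∈ r≢s r∈ s∈ =
      ≤-trans (proj₁ (edge-between p≢q p∈ q∈ dis r∈)) (s≤s 3≤D) , All.tabulate among
      where
      reach : ∀ {t x y} → t ∈ˡ H → x ≢ y → ∃[ A ] A ∈ˡ G × x ∈ A × y ∈ A → x ∈ t ⊎ y ∈ t
      reach {t} t∈ x≢y (A , A∈ , x∈A , y∈A) with cross A∈ t∈
      ... | z , z∈A , z∈t with only-two (All.lookup (proj₂ g) A∈) x≢y x∈A y∈A z∈A
      ...   | inj₁ z≡x = inj₁ (subst (_∈ t) z≡x z∈t)
      ...   | inj₂ z≡y = inj₂ (subst (_∈ t) z≡y z∈t)
      hit : ∀ {t x x′ y} → t ∈ˡ H → x ≢ x′ → x ∈ h₁ → x′ ∈ h₁ → y ∈ h₂ → x ∈ t ⊎ y ∈ t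
      hit t∈ x≢x′ x∈ x′∈ y∈ = reach t∈ (λ x≡y → dis (_ , x∈ , subst (_∈ h₂) (sym x≡y) y∈))
        (proj₂ (edge-between x≢x′ x∈ x′∈ dis y∈))
      among : ∀ {t} → t ∈ˡ H → t ∈ˡ h₁ ∷ h₂ ∷ []
      among {t} t∈ = two-covers is₁ is₂
          (hit t∈ p≢q p∈ q∈ r∈) (hit t∈ p≢q p∈ q∈ s∈)
          (hit t∈ (p≢q ∘ sym) q∈ p∈ r∈) (hit t∈ (p≢q ∘ sym) q∈ p∈ s∈)
        where
        is₁ : p ∈ t → q ∈ t → t ∈ˡ h₁ ∷ h₂ ∷ []
        is₁ p∈t q∈t = here (two-unique (All.lookup sz t∈) sz₁ p≢q p∈t q∈t p∈ q∈)
        is₂ : r ∈ t → s ∈ t → t ∈ˡ h₁ ∷ h₂ ∷ []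
        is₂ r∈t s∈t = there (here (two-unique (All.lookup sz t∈) sz₂ r≢s r∈t s∈t r∈ s∈))

    two-transversals : Conclusion h₁ h₂
    two-transversals with nonempty? (h₁ ∩ h₂)
    ... | yes (p , p∈) =
      let p∈₁ , p∈₂ = x∈p∩q⁻ h₁ h₂ p∈
          _ , p≢q , q∈ = other sz₁ p∈₁
          _ , p≢r , r∈ = other sz₂ p∈₂
      in adjacent p∈₁ p∈₂ p≢q q∈ p≢r r∈
    ... | no ∅ =
      let _ , _ , p≢q , p∈ , q∈ = two-elements h₁ sz₁
          _ , _ , r≢s , r∈ , s∈ = two-elements h₂ sz₂
      in disjoint (λ (z , z∈₁ , z∈₂) → ∅ (z , x∈p∩q⁺ (z∈₁ , z∈₂))) p≢q p∈ q∈ r≢s r∈ s∈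

-- The factor 2 lets the inequalities for two graphs `H` and `K` be averaged later. A single edge of
-- `H` covers `G` and gives `length G ≤ 2 * D`; two edges bring in `two-transversals`.
large⇒dominates : {G H : List (Subset n)} → 3 ≤ D → IsGraph G → MaxDegree≤ D G → IsGraph H → Cross G H →
                  D < length G → length H ≡ 0 ⊎ length G + 2 * length H ≤ 3 * D
large⇒dominates {H = []} _ _ _ _ _ _ = inj₁ refl
large⇒dominates {D = D} {G = G} {h ∷ []} 3≤D g deg (_ , sz ∷ []) cr _ = inj₂ (begin
  length G + 2               ≤⟨ +-mono-≤ |G| (≤-trans (n≤1+n 2) 3≤D) ⟩
  2 * D + D                  ≡⟨ +-comm (2 * D) D ⟩
  3 * D                      ∎)
  where
  open ≤-Reasoning
  |G| : length G ≤ 2 * D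
  |G| = subst (λ l → length G ≤ l * D) (trans (length-elements h) sz)
    (cover G D deg (elements h) (All.tabulate λ A∈ →
      let z , z∈A , z∈h = cr A∈ (here refl) in Any.map (λ { refl → z∈A }) (∈-elements z∈h)))
large⇒dominates {D = D} {G = G} {H@(h₁ ∷ h₂ ∷ _)} 3≤D g deg (u@((h₁≢h₂ ∷ _) ∷ _) , sz) cr D<G = inj₂ (begin
  length G + 2 * length H    ≤⟨ +-mono-≤ (proj₁ T) (*-monoʳ-≤ 2 (unique-⊆-length u (proj₂ T))) ⟩
  suc D + 4                  ≡⟨ cong suc (+-comm D 4) ⟩
  -- `5 ≤ 6 ≤ 2 * D` by `3 ≤ D`.
  5 + D                      ≤⟨ +-monoˡ-≤ D (≤-trans (n≤1+n 5) (*-monoʳ-≤ 2 3≤D)) ⟩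
  2 * D + D                  ≡⟨ +-comm (2 * D) D ⟩
  3 * D                      ∎)
  where
  open ≤-Reasoning
  T = Transversals.two-transversals g deg sz cr 3≤D D<G (here refl) (there (here refl)) h₁≢h₂

-- If `H` and `K` are empty, `G` alone is bounded by `CH D q`. If one is nonempty, `large⇒dominates`
-- suffices; if both are, its two inequalities are added and halved.
large-cross-bound : ∀ {q} {G H K : List (Subset n)} → 3 ≤ D → BoundedGraph D q G → IsGraph H → IsGraph K →
                    Cross G H → Cross G K → D < length G →
                    length G + (length H + length K) ≤ CH D q ⊔ 3 * D
large-cross-bound {D = D} {q} {G} {H} {K} 3≤D bG@(gG , deg , _) gH gK GH GK D<G =
  combine (large⇒dominates 3≤D gG deg gH GH D<G) (large⇒dominates 3≤D gG deg gK GK D<G)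
  where
  open ≤-Reasoning
  a = length G
  a≤ : ∀ {b} → a + 2 * b ≤ 3 * D → a + b ≤ CH D q ⊔ 3 * D
  a≤ le = ≤-trans (≤-trans (+-monoʳ-≤ a (m≤n*m _ 2)) le) (m≤n⊔m (CH D q) (3 * D))
  double : ∀ a b c → 2 * (a + (b + c)) ≡ (a + 2 * b) + (a + 2 * c)
  double = solve-∀
  combine : ∀ {b c} → b ≡ 0 ⊎ a + 2 * b ≤ 3 * D → c ≡ 0 ⊎ a + 2 * c ≤ 3 * D → a + (b + c) ≤ CH D q ⊔ 3 * D
  combine (inj₁ refl) (inj₁ refl) = ≤-trans (≤-reflexive (+-identityʳ a))
    (≤-trans (proj₂ (CH-isMaximum D q) a (_ , G , refl , bG)) (m≤m⊔n _ _))
  combine (inj₁ refl) (inj₂ le) = a≤ le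
  combine {b} (inj₂ le) (inj₁ refl) = subst (λ b → a + b ≤ CH D q ⊔ 3 * D) (sym (+-identityʳ b)) (a≤ le)
  combine {b} {c} (inj₂ le) (inj₂ le′) = ≤-trans (*-cancelˡ-≤ {a + (b + c)} {3 * D} 2 (begin
    2 * (a + (b + c))          ≡⟨ double a b c ⟩
    (a + 2 * b) + (a + 2 * c)  ≤⟨ +-mono-≤ le le′ ⟩
    3 * D + 3 * D              ≡⟨ cong (3 * D +_) (sym (+-identityʳ (3 * D))) ⟩
    2 * (3 * D)                ∎)) (m≤n⊔m (CH D q) (3 * D))

-- Either some graph has more than `D` edges and takes the role of `G` in `large-cross-bound`, or
-- the sum is trivially at most `3 * D`.
cross-bound : ∀ {q} {G H K : List (Subset n)} → 3 ≤ D →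
              BoundedGraph D q G → BoundedGraph D q H → BoundedGraph D q K →
              Cross G H → Cross G K → Cross H K →
              length G + (length H + length K) ≤ CH D q ⊔ 3 * D
cross-bound {D = D} {q} {G} {H} {K} 3≤D bG bH bK GH GK HK
  with length G ≤? D | length H ≤? D | length K ≤? D
... | no ¬le | _ | _ = large-cross-bound 3≤D bG (proj₁ bH) (proj₁ bK) GH GK (≰⇒> ¬le)
... | yes _ | no ¬le | _ = subst (_≤ CH D q ⊔ 3 * D) (rotate (length G) (length H) (length K))
  (large-cross-bound 3≤D bH (proj₁ bG) (proj₁ bK) (Cross-sym GH) HK (≰⇒> ¬le))
  where
  rotate : ∀ a b c → b + (a + c) ≡ a + (b + c)
  rotate = solve-∀
... | yes _ | yes _ | no ¬le = subst (_≤ CH D q ⊔ 3 * D) (rotate (length G) (length H) (length K))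
  (large-cross-bound 3≤D bK (proj₁ bG) (proj₁ bH) (Cross-sym GK) (Cross-sym HK) (≰⇒> ¬le))
  where
  rotate : ∀ a b c → c + (a + b) ≡ a + (b + c)
  rotate = solve-∀
... | yes a | yes b | yes c = ≤-trans (+-mono-≤ a (+-mono-≤ b
  (≤-trans c (≤-reflexive (sym (+-identityʳ D)))))) (m≤n⊔m _ _)

-- Links

⊥-restore : (x : Fin n) → ⊥ [ x ]≔ inside ≡ ⁅ x ⁆
⊥-restore zero    = refl
⊥-restore (suc x) = cong (outside ∷_) (⊥-restore x)

-- Two equal members would coincide with their intersection, the core, which the sizes exclude.
core-unique : ∀ {S : List (Subset n)} {C} → All (λ A → ∣ A ∣ ≢ ∣ C ∣) S → HasCore S C → Unique S
core-unique [] [] = []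
core-unique {S = A ∷ _} (s ∷ ss) (core ∷ cores) =
  All.map (λ eq A≡B → s (cong ∣_∣ (trans (sym (∩-idem A)) (trans (cong (A ∩_) A≡B) eq)))) core
  ∷ core-unique ss cores

link : Fin n → List (Subset n) → List (Subset n)
link x = map (_[ x ]≔ outside)

module Link {F L : List (Subset n)} {x} (uF : IsUniformFamily (suc w) F)
            (uL : Unique L) (L⊆ : All (_∈ˡ F) L) (x∈ : All (x ∈_) L) where

  private
    restore : Subset n → Subset n
    restore B = B [ x ]≔ inside

    restore-delete : ∀ {A} → A ∈ˡ L → restore (A [ x ]≔ outside) ≡ A
    restore-delete A∈ = delete-restore x (All.lookup x∈ A∈)

    restore-∈ : ∀ {B} → B ∈ˡ link x L → restore B ∈ˡ L
    restore-∈ B∈ = proj₁ (pull (_[ x ]≔ outside) restore restore-delete B∈)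

  -- Restoring `x` undoes the deletion and commutes with `∩`, so a sunflower in the link lifts to
  -- one in `F` whose core gains `x`.
  link-free : SunflowerFree k F → UniformSunflowerFree w k (link x L)
  link-free free =
    ( push-unique _ restore restore-delete uL
    , All.map⁺ (All.zipWith (λ (x∈A , s) → suc-injective (trans (∣delete∣ x∈A) s))
        (x∈ , all-∈ (proj₂ uF) L⊆)))
    , push-free _ restore restore-delete (restore-∩ x)
        λ (S , len , S⊆ , sun) → free (S , len , all-∈ L⊆ S⊆ , sun)

  length≤f : SunflowerFree (suc D) F → length L ≤ f w (suc D)
  length≤f free = proj₂ (f-isMaximum w (suc _)) _ (_ , link x L , length-map _ L , link-free free)

  -- A matching lifts to sets of `F` that pairwise meet in `⁅ x ⁆` only. Together with `e` they form
  -- a sunflower, which has at most `D` members; `e` accounts for the `∸ 1`.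
  link-matching : 1 ≤ w → SunflowerFree (suc D) F → ∀ {e} → e ∈ˡ F → All (λ A → e ∩ A ≡ ⁅ x ⁆) L →
                  MatchingNumber≤ (D ∸ 1) (link x L)
  link-matching 1≤w free {e} e∈ core N (N⊆ , dis) =
    subst (_≤ _) (length-map restore N) (∸-monoˡ-≤ 1
      (free⇒< free S⊆ (core-unique (All.map (λ {A} → size≢ A) (all-∈ (proj₂ uF) S⊆)) S-core , ⁅ x ⁆ , S-core)))
    where
    N′⊆ : All (_∈ˡ L) (map restore N)
    N′⊆ = All.map⁺ (All.map restore-∈ N⊆)
    S⊆ : All (_∈ˡ F) (e ∷ map restore N)
    S⊆ = e∈ ∷ all-∈ L⊆ N′⊆
    S-core : HasCore (e ∷ map restore N) ⁅ x ⁆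
    S-core = all-∈ core N′⊆ ∷ AllPairs.map⁺ (AllPairs.map
      (λ {A} {B} eq → trans (sym (restore-∩ x A B)) (trans (cong restore eq) (⊥-restore x))) dis)
    -- Members of `F` have at least two elements by `1 ≤ w`, so none is the core and `core-unique`
    -- applies.
    size≢ : (A : Subset n) → ∣ A ∣ ≡ suc w → ∣ A ∣ ≢ ∣ ⁅ x ⁆ ∣
    size≢ A s eq = <⇒≢ 1≤w (sym (suc-injective (trans (sym s) (trans eq (∣⁅x⁆∣≡1 x)))))

-- Sums over lists

total : (X → ℕ) → List X → ℕ
total g xs = sum (map g xs)

ind : {P : Set} → Dec P → ℕ
ind (yes _) = 1
ind (no _)  = 0

ind-yes : {P : Set} (d : Dec P) → P → ind d ≡ 1
ind-yes (yes _) _ = refl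
ind-yes (no ¬p) p = contradiction p ¬p

length-filter≡total : {P : X → Set} (P? : ∀ x → Dec (P x)) (xs : List X) →
                      length (filter P? xs) ≡ total (λ x → ind (P? x)) xs
length-filter≡total P? []       = refl
length-filter≡total P? (x ∷ xs) with P? x
... | yes _ = cong suc (length-filter≡total P? xs)
... | no _  = length-filter≡total P? xs

total-+ : (g h : X → ℕ) (xs : List X) → total (λ x → g x + h x) xs ≡ total g xs + total h xs
total-+ g h []       = refl
total-+ g h (x ∷ xs) = trans (cong (g x + h x +_) (total-+ g h xs)) (interchange (g x) (h x) _ _)
  where
  interchange : ∀ a b c d → (a + b) + (c + d) ≡ (a + c) + (b + d)
  interchange = solve-∀

total-mono : {g h : X → ℕ} {xs : List X} → All (λ x → g x ≤ h x) xs → total g xs ≤ total h xs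
total-mono []       = z≤n
total-mono (p ∷ ps) = +-mono-≤ p (total-mono ps)

total-const : ∀ m (xs : List X) → total (λ _ → m) xs ≡ length xs * m
total-const m []       = refl
total-const m (_ ∷ xs) = cong (m +_) (total-const m xs)

total-swap : ∀ {Y : Set} (g : X → Y → ℕ) xs ys →
             total (λ x → total (g x) ys) xs ≡ total (λ y → total (λ x → g x y) xs) ys
total-swap g []       ys = sym (trans (total-const 0 ys) (*-zeroʳ (length ys)))
total-swap g (x ∷ xs) ys = trans (cong (total (g x) ys +_) (total-swap g xs ys)) (sym (total-+ (g x) _ ys))

total-∈ : ∀ (g : X → ℕ) {x xs} → x ∈ˡ xs → g x ≤ total g xs
total-∈ g (here refl)        = m≤m+n _ _
total-∈ g {xs = y ∷ _} (there x∈) = ≤-trans (total-∈ g x∈) (m≤n+m _ (g y))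

total-∈₂ : ∀ (g : X → ℕ) {x y xs} → x ∈ˡ xs → y ∈ˡ xs → x ≢ y → g x + g y ≤ total g xs
total-∈₂ g (here refl) (here refl) x≢y = contradiction refl x≢y
total-∈₂ g {x} (here refl) (there y∈) _ = +-monoʳ-≤ (g x) (total-∈ g y∈)
total-∈₂ g {x} {y} (there x∈) (here refl) _ =
  ≤-trans (≤-reflexive (+-comm (g x) (g y))) (+-monoʳ-≤ (g y) (total-∈ g x∈))
total-∈₂ g {xs = z ∷ _} (there x∈) (there y∈) x≢y = ≤-trans (total-∈₂ g x∈ y∈ x≢y) (m≤n+m _ (g z))

total-points : ∀ (g : Fin n → ℕ) {b M} → All (λ e → total g (elements e) ≤ b) M → total g (points M) ≤ length M * b
total-points g [] = z≤n
total-points g {M = e ∷ M} (p ∷ ps) = ≤-trans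
  (≤-reflexive (trans (cong sum (map-++ g (elements e) (points M))) (sum-++ (map g (elements e)) _)))
  (+-mono-≤ p (total-points g ps))

-- Maximum matchings

IsMaximumMatching : List (Subset n) → List (Subset n) → Set
IsMaximumMatching F M = IsMatching F M × (∀ M′ → IsMatching F M′ → length M′ ≤ length M)

-- The sizes of matchings are bounded by `q` and decidable by exhaustive search, so a largest one
-- can be found.
maximum-matching : ∀ {q} {F : List (Subset n)} → MatchingNumber≤ q F → ∃[ M ] IsMaximumMatching F M
maximum-matching {q = q} {F} ν≤
  with search (λ m → ∃[ M ] length M ≡ m × IsMatching F M)
    (λ m → anyList? m (λ M → members? F M ×-dec allPairs? (λ A B → (A ∩ B) ≟ˢ ⊥) M))
    ([] , refl , [] , []) q (λ { _ (M , refl , MF) → ν≤ M MF })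
... | _ , (M , refl , MF) , max = M , MF , λ M′ MF′ → max _ (M′ , refl , MF′)

module MaximumMatching {F M : List (Subset n)} (uF : IsUniformFamily (suc w) F)
                       (isMax : IsMaximumMatching F M) where

  private
    M⊆  = proj₁ (proj₁ isMax)
    dis = proj₂ (proj₁ isMax)
    max = proj₂ isMax

  matching-unique : Unique M
  matching-unique = disjoint⇒unique (all-∈ (proj₂ uF) M⊆) dis

  Private : Fin n → Subset n → Set
  Private x A = x ∈ A × All (λ y → y ∈ A → y ≡ x) (points M)

  private? : ∀ x A → Dec (Private x A)
  private? x A = x ∈? A ×-dec All.all? (λ y → y ∈? A →-dec y ≟ᶠ x) (points M)

  private-meet : ∀ {x A C z} → Private x A → C ∈ˡ M → z ∈ C → z ∈ A → z ≡ x
  private-meet (_ , only) C∈ z∈C = All.lookup only (∈-points C∈ z∈C)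

  shared-point : ∀ {e C x} → e ∈ˡ M → C ∈ˡ M → x ∈ e → x ∈ C → e ≡ C
  shared-point {e} {C} e∈ C∈ x∈e x∈C with e ≟ˢ C
  ... | yes eq = eq
  ... | no e≢C = contradiction (subst (_ ∈_) e∩C (x∈p∩q⁺ (x∈e , x∈C))) ∉⊥
    where
    e∩C : e ∩ C ≡ ⊥
    e∩C = allPairs-lookup (λ {A} {B} eq → trans (∩-comm B A) eq) dis e∈ C∈ e≢C

  -- A set missing every point of `M` could be added to `M`.
  hits : ∀ {A} → A ∈ˡ F → ∃[ x ] x ∈ˡ points M × x ∈ A
  hits {A} A∈ with Any.any? (_∈? A) (points M)
  ... | yes hit = find hit
  ... | no miss = contradiction (max (A ∷ M) (A∈ ∷ M⊆ , All.tabulate apart ∷ dis)) 1+n≰n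
    where
    apart : ∀ {C} → C ∈ˡ M → A ∩ C ≡ ⊥
    apart {C} C∈ = empty⇒⊥ λ z∈ → let z∈A , z∈C = x∈p∩q⁻ A C z∈ in miss (lose (∈-points C∈ z∈C) z∈A)

  -- Otherwise replacing e by A and B would enlarge M.
  privates-meet : ∀ {e x y A B} → e ∈ˡ M → x ∈ e → y ∈ e → A ∈ˡ F → B ∈ˡ F →
                  Private x A → Private y B → Meets A B
  privates-meet {e} {x} {y} {A} {B} e∈ x∈e y∈e A∈ B∈ pA pB with nonempty? (A ∩ B)
  ... | yes (z , z∈) = z , x∈p∩q⁻ A B z∈
  ... | no ∅ = contradiction (≤-trans (max (A ∷ B ∷ M′) augmented)
    (≤-trans (≤-reflexive (split M x)) (+-monoˡ-≤ (length M′) deg≤1))) 1+n≰n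
    where
    x∉? = λ C → ¬? (x ∈? C)
    M′ = filter x∉? M
    M′-∈ : ∀ {C} → C ∈ˡ M′ → C ∈ˡ M × x ∉ C
    M′-∈ = ∈-filter⁻ x∉? {xs = M}
    Mₓ-∈ : ∀ {C} → C ∈ˡ filter (x ∈?_) M → C ∈ˡ M × x ∈ C
    Mₓ-∈ = ∈-filter⁻ (x ∈?_) {xs = M}
    deg≤1 : degree M x ≤ 1
    deg≤1 = subsingleton-length (AllPairs.filter⁺ (x ∈?_) matching-unique) λ C∈ C′∈ →
      shared-point (proj₁ (Mₓ-∈ C∈)) (proj₁ (Mₓ-∈ C′∈)) (proj₂ (Mₓ-∈ C∈)) (proj₂ (Mₓ-∈ C′∈))
    A-apart : ∀ {C} → C ∈ˡ M′ → A ∩ C ≡ ⊥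
    A-apart {C} C∈ = empty⇒⊥ λ z∈ →
      let z∈A , z∈C = x∈p∩q⁻ A C z∈
          C∈M , x∉C = M′-∈ C∈
      in x∉C (subst (_∈ C) (private-meet pA C∈M z∈C z∈A) z∈C)
    B-apart : ∀ {C} → C ∈ˡ M′ → B ∩ C ≡ ⊥
    B-apart {C} C∈ = empty⇒⊥ λ z∈ →
      let z∈B , z∈C = x∈p∩q⁻ B C z∈
          C∈M , x∉C = M′-∈ C∈
          y∈C = subst (_∈ C) (private-meet pB C∈M z∈C z∈B) z∈C
      in x∉C (subst (x ∈_) (shared-point e∈ C∈M y∈e y∈C) x∈e)
    augmented : IsMatching F (A ∷ B ∷ M′)
    augmented = A∈ ∷ B∈ ∷ All.filter⁺ x∉? M⊆
      , (empty⇒⊥ (λ z∈ → ∅ (_ , z∈)) ∷ All.tabulate A-apart)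
      ∷ All.tabulate B-apart ∷ AllPairs.filter⁺ x∉? dis

  matched? : ∀ A → Dec (A ∈ˡ M)
  matched? A = Any.any? (A ≟ˢ_) M

  weight : Fin n → Subset n → ℕ
  weight x A = ind (x ∈? A) + ind (private? x A)

  weight-∈ : ∀ {x A} → x ∈ A → 1 ≤ weight x A
  weight-∈ {x} {A} x∈ = ≤-trans (≤-reflexive (sym (ind-yes (x ∈? A) x∈))) (m≤m+n _ _)

  -- A member of `M` has all its `suc w` points, at least three, among `points M`. Any other set has
  -- either two points there, each of weight at least 1, or a single one, to which it is private and
  -- which therefore has weight 2.
  total-weight : ∀ {A} → 2 ≤ w → A ∈ˡ F → 2 + ind (matched? A) ≤ total (λ x → weight x A) (points M)
  total-weight {A} 2≤w A∈ with matched? A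
  ... | yes A∈M = begin
    3                                           ≤⟨ s≤s 2≤w ⟩
    suc w                                       ≡⟨ sym (trans (length-elements A) (All.lookup (proj₂ uF) A∈)) ⟩
    length (elements A)                         ≤⟨ unique-⊆-length (elements-unique A) elements⊆ ⟩
    length (filter (_∈? A) (points M))          ≡⟨ length-filter≡total (_∈? A) (points M) ⟩
    total (λ x → ind (x ∈? A)) (points M)       ≤⟨ total-mono (All.universal (λ _ → m≤m+n _ _) (points M)) ⟩
    total (λ x → weight x A) (points M)         ∎
    where
    open ≤-Reasoning
    elements⊆ : All (_∈ˡ filter (_∈? A) (points M)) (elements A)
    elements⊆ = All.map (λ x∈ → ∈-filter⁺ (_∈? A) (∈-points A∈M x∈) x∈) (∈-elements⁻ A)
  ... | no _ = unmatched (hits A∈)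
    where
    unmatched : ∃[ x ] x ∈ˡ points M × x ∈ A → 2 ≤ total (λ x → weight x A) (points M)
    unmatched (x , x∈pts , x∈A) with Any.any? (λ y → y ∈? A ×-dec ¬? (x ≟ᶠ y)) (points M)
    ... | yes another =
      let y , y∈pts , y∈A , x≢y = find another
      in ≤-trans (+-mono-≤ (weight-∈ x∈A) (weight-∈ y∈A)) (total-∈₂ (λ x → weight x A) x∈pts y∈pts x≢y)
    ... | no none = ≤-trans
        (≤-reflexive (sym (cong₂ _+_ (ind-yes (x ∈? A) x∈A) (ind-yes (private? x A) (x∈A , All.tabulate only)))))
        (total-∈ (λ x → weight x A) x∈pts)
      where
      only : ∀ {y} → y ∈ˡ points M → y ∈ A → y ≡ x
      only {y} y∈pts y∈A with x ≟ᶠ y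
      ... | yes x≡y = sym x≡y
      ... | no x≢y  = contradiction (lose y∈pts (y∈A , x≢y)) none

  -- The weights are summed over all sets and points of `M` in both orders; the points are then
  -- grouped by the edges of `M`. The members of `M` contribute the extra `length M`.
  double-count : ∀ {b} → 2 ≤ w → (∀ {e} → e ∈ˡ M → total (λ x → total (weight x) F) (elements e) ≤ b) →
                 2 * length F + length M ≤ length M * b
  double-count {b} 2≤w edge = begin
    2 * length F + length M
      ≤⟨ +-mono-≤ (≤-reflexive (*-comm 2 (length F))) (unique-⊆-length matching-unique matched) ⟩
    length F * 2 + length (filter matched? F)
      ≡⟨ cong₂ _+_ (sym (total-const 2 F)) (length-filter≡total matched? F) ⟩
    total (λ _ → 2) F + total (λ A → ind (matched? A)) F
      ≡⟨ sym (total-+ (λ _ → 2) (λ A → ind (matched? A)) F) ⟩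
    total (λ A → 2 + ind (matched? A)) F
      ≤⟨ total-mono (All.tabulate (total-weight 2≤w)) ⟩
    total (λ A → total (λ x → weight x A) (points M)) F
      ≡⟨ sym (total-swap weight (points M) F) ⟩
    total (λ x → total (weight x) F) (points M)
      ≤⟨ total-points (λ x → total (weight x) F) (All.tabulate edge) ⟩
    length M * b
      ∎
    where
    open ≤-Reasoning
    matched : All (_∈ˡ filter matched? F) M
    matched = All.tabulate λ e∈ → ∈-filter⁺ matched? (All.lookup M⊆ e∈) e∈

-- The bound for 3-uniform families

module Triples {F M : List (Subset n)} (3≤D : 3 ≤ D) (uF : IsUniformFamily 3 F) (free : SunflowerFree (suc D) F)
               (isMax : IsMaximumMatching F M) where

  open MaximumMatching uF isMax

  privates : Fin n → List (Subset n)
  privates x = filter (private? x) F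

  privates-∈ : ∀ {x A} → A ∈ˡ privates x → A ∈ˡ F × Private x A
  privates-∈ {x} = ∈-filter⁻ (private? x) {xs = F}

  private-link : Fin n → List (Subset n)
  private-link x = link x (privates x)

  -- Sets private to `x` and to `y` meet by `privates-meet`. A common point is neither `x` nor `y`,
  -- as each set has only one point in `e`, so it survives both deletions.
  private-link-cross : ∀ {e x y} → e ∈ˡ M → x ∈ e → y ∈ e → x ≢ y → Cross (private-link x) (private-link y)
  private-link-cross {e} {x} {y} e∈ x∈ y∈ x≢y A′∈ B′∈ with ∈-map⁻ (_[ x ]≔ outside) A′∈ | ∈-map⁻ (_[ y ]≔ outside) B′∈
  ... | A , A∈ , refl | B , B∈ , refl =
    let A∈F , pA = privates-∈ A∈
        B∈F , pB = privates-∈ B∈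
        z , z∈A , z∈B = privates-meet e∈ x∈ y∈ A∈F B∈F pA pB
        z≢x = λ z≡x → x≢y (private-meet pB e∈ x∈ (subst (_∈ B) z≡x z∈B))
        z≢y = λ z≡y → x≢y (sym (private-meet pA e∈ y∈ (subst (_∈ A) z≡y z∈A)))
    in z , []≔-minimal A z x z≢x z∈A , []≔-minimal B z y z≢y z∈B

  -- Sets private to `x` meet `e` exactly in `x`, so `e` can serve as the additional petal in
  -- `link-matching`.
  private-link-bounded : ∀ {e x} → e ∈ˡ M → x ∈ e → BoundedGraph D (D ∸ 1) (private-link x)
  private-link-bounded {e} {x} e∈ x∈ =
    let g , deg , _ = free⇒bounded (L.link-free free)
    in g , deg , L.link-matching (s≤s z≤n) free (All.lookup (proj₁ (proj₁ isMax)) e∈) (All.tabulate core)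
    where
    module L = Link uF (AllPairs.filter⁺ (private? x) (proj₁ uF))
      (All.tabulate (λ A∈ → proj₁ (privates-∈ A∈))) (All.tabulate (λ A∈ → proj₁ (proj₂ (privates-∈ A∈))))
    core : ∀ {A} → A ∈ˡ privates x → e ∩ A ≡ ⁅ x ⁆
    core {A} A∈ = ⊆-antisym to from
      where
      pA = proj₂ (privates-∈ A∈)
      to : e ∩ A ⊆ ⁅ x ⁆
      to z∈ = let z∈e , z∈A = x∈p∩q⁻ e A z∈
              in subst (_∈ ⁅ x ⁆) (sym (private-meet pA e∈ z∈e z∈A)) (x∈⁅x⁆ x)
      from : ⁅ x ⁆ ⊆ e ∩ A
      from z∈ = subst (_∈ e ∩ A) (sym (x∈⁅y⁆⇒x≡y x z∈)) (x∈p∩q⁺ (x∈ , proj₁ pA))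

  degree≤f : ∀ x → degree F x ≤ f 2 (suc D)
  degree≤f x = Link.length≤f uF (AllPairs.filter⁺ (x ∈?_) (proj₁ uF))
    (All.tabulate (λ A∈ → proj₁ (∈-filter⁻ (x ∈?_) {xs = F} A∈))) (All.all-filter (x ∈?_) F) free

  total-weight≡ : ∀ x → total (weight x) F ≡ degree F x + length (private-link x)
  total-weight≡ x = trans (total-+ (λ A → ind (x ∈? A)) (λ A → ind (private? x A)) F) (cong₂ _+_
    (sym (length-filter≡total (x ∈?_) F))
    (trans (sym (length-filter≡total (private? x) F)) (sym (length-map _ (privates x)))))

  -- Stated for any list of three points of `e`, because `elements e` does not reduce to an explicit
  -- triple.
  edge-weight : ∀ {e} → e ∈ˡ M → ∀ xs → length xs ≡ 3 → Unique xs → All (_∈ e) xs →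
                total (λ x → total (weight x) F) xs ≤ c (suc D) + 3 * f 2 (suc D)
  edge-weight e∈ (x ∷ y ∷ z ∷ []) _ ((x≢y ∷ x≢z ∷ []) ∷ (y≢z ∷ []) ∷ _) (x∈ ∷ y∈ ∷ z∈ ∷ []) = begin
    W x + (W y + (W z + 0))
      ≤⟨ +-mono-≤ (W≤ x) (+-mono-≤ (W≤ y) (+-monoˡ-≤ 0 (W≤ z))) ⟩
    (h₀ + g x) + ((h₀ + g y) + ((h₀ + g z) + 0))
      ≡⟨ regroup h₀ (g x) (g y) (g z) ⟩
    (g x + (g y + g z)) + 3 * h₀
      -- With `q` equal to `D ∸ 1`, the bound of `cross-bound` is `c (suc D)` by definition.
      ≤⟨ +-monoˡ-≤ (3 * h₀) (cross-bound 3≤D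
           (private-link-bounded e∈ x∈) (private-link-bounded e∈ y∈) (private-link-bounded e∈ z∈)
           (private-link-cross e∈ x∈ y∈ x≢y) (private-link-cross e∈ x∈ z∈ x≢z) (private-link-cross e∈ y∈ z∈ y≢z)) ⟩
    c (suc D) + 3 * h₀
      ∎
    where
    open ≤-Reasoning
    W g : Fin n → ℕ
    W x = total (weight x) F
    g x = length (private-link x)
    h₀ = f 2 (suc D)
    W≤ : ∀ x → W x ≤ h₀ + g x
    W≤ x = ≤-trans (≤-reflexive (total-weight≡ x)) (+-monoˡ-≤ (g x) (degree≤f x))
    regroup : ∀ h₀ a b c → (h₀ + a) + ((h₀ + b) + ((h₀ + c) + 0)) ≡ (a + (b + c)) + 3 * h₀
    regroup = solve-∀

  size-bound : 2 * length F ≤ D * (c (suc D) + 3 * f 2 (suc D) ∸ 1)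
  size-bound = begin
    -- Moving `length M` to the right is the source of the `∸ 1`; only afterwards is `length M`
    -- replaced by its bound `D`.
    2 * length F                     ≤⟨ m+n≤o⇒m≤o∸n (2 * length F) (double-count ≤-refl edge) ⟩
    length M * b ∸ length M          ≡⟨ cong (length M * b ∸_) (sym (*-identityʳ (length M))) ⟩
    length M * b ∸ length M * 1      ≡⟨ sym (*-distribˡ-∸ (length M) b 1) ⟩
    length M * (b ∸ 1)               ≤⟨ *-monoˡ-≤ (b ∸ 1) (free⇒matching uF free M (proj₁ isMax)) ⟩
    D * (b ∸ 1)                      ∎
    where
    open ≤-Reasoning
    b = c (suc D) + 3 * f 2 (suc D)
    edge : ∀ {e} → e ∈ˡ M → total (λ x → total (weight x) F) (elements e) ≤ b
    edge {e} e∈ = edge-weight e∈ (elements e)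
      (trans (length-elements e) (All.lookup (proj₂ uF) (All.lookup (proj₁ (proj₁ isMax)) e∈)))
      (elements-unique e) (∈-elements⁻ e)

-- The inequality is doubled to avoid the fraction. The truncated subtraction of 1 is exact, since
-- `c k` is at least `3 * (k ∸ 1)`, which is positive.
theorem4p2 : (k : ℕ) → 4 ≤ k →
    h k ≡ f 2 k × 2 * f 3 k ≤ (k ∸ 1) * (c k + 3 * h k ∸ 1)
theorem4p2 (suc D) (s≤s 3≤D) = h≡ , bound (proj₁ (f-isMaximum 3 (suc D)))
  where
  h≡ : h (suc D) ≡ f 2 (suc D)
  h≡ = h≡f (≤-trans (s≤s z≤n) 3≤D)
  -- Generalising `f 3 (suc D)` to an arbitrary attained size `m` permits matching `length F ≡ m`
  -- with `refl`.
  bound : ∀ {m} → SizeOf (UniformSunflowerFree 3 (suc D)) m → 2 * m ≤ D * (c (suc D) + 3 * h (suc D) ∸ 1)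
  bound (_ , F , refl , uF , free) = subst (λ m → 2 * length F ≤ D * (c (suc D) + 3 * m ∸ 1)) (sym h≡)
    (Triples.size-bound 3≤D uF free (proj₂ (maximum-matching (free⇒matching uF free))))
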